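{- Suppose $(S,\to,\twoheadrightarrow,\hookrightarrow)$ is a two-acyclic factorization system that obeys the image condition and $C\subseteq S$ is a $\rightsquigarrow$-upset. Then the restriction of $(S,\to,\twoheadrightarrow,\hookrightarrow)$ to $C$ is a two-acyclic factorization system that obeys the image condition. The map $(X,Y)\mapsto(X\cap C,Y\cap C)$ is a surjective complete lattice homomorphism between the corresponding lattices of maximal orthogonal pairs (from $\operatorname{Pairs}(\to)$ to $\operatorname{Pairs}(\to|_C)$). The complete congruence associated to $(X,Y)\mapsto(X\cap C,Y\cap C)$ is cover-determined. Every complete cover-determined congruence on $\operatorname{Pairs}(\to)$ arises from a $\rightsquigarrow$-upset in this way.
   Context: For a binary relation $\to$ on a set $S$ and $X\subseteq S$, put $X^\perp=\{y\in S: x\not\to y\ \forall x\in X\}$ and ${}^\perp X=\{y\in S: y\not\to x\ \forall x\in X\}$. A maximal orthogonal pair is a pair $(X,Y)$ of subsets of $S$ with $Y=X^\perp$ and $X={}^\perp Y$. $\operatorname{Pairs}(\to)$ is the complete lattice of maximal orthogonal pairs, partially ordered by containment of first components (equivalently reverse containment of second components). For a reflexive relation $\to$ on $S$, $\operatorname{Fact}(\to)=(\twoheadrightarrow,\hookrightarrow)$, where $x\twoheadrightarrow y$ iff for all $z$, $y\to z$ implies $x\to z$, and $x\hookrightarrow y$ iff for all $z$, $z\to x$ implies $z\to y$. For preorders $\twoheadrightarrow,\hookrightarrow$ on $S$, $\operatorname{Mult}(\twoheadrightarrow,\hookrightarrow)$ is the relation relating $x$ to $z$ iff there is $y\in S$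 with $x\twoheadrightarrow y\hookrightarrow z$. A factorization system is a tuple $(S,\to,\twoheadrightarrow,\hookrightarrow)$ ($S$ possibly infinite) with $\to$ reflexive, $\operatorname{Fact}(\to)=(\twoheadrightarrow,\hookrightarrow)$ and $\operatorname{Mult}(\twoheadrightarrow,\hookrightarrow)=\to$. It is two-acyclic if $x\twoheadrightarrow y\twoheadrightarrow x$ implies $x=y$, $x\hookrightarrow y\hookrightarrow x$ implies $x=y$, and $x\twoheadrightarrow y\hookrightarrow x$ implies $x=y$. Its restriction to $C\subseteq S$ restricts all three relations to $C$. Convention: $x\twoheadrightarrow y$ or $x\hookrightarrow y$ is read as "$x$ is greater than or equal to $y$"; thus $x$ is $\twoheadrightarrow$-minimal in $A\ni x$ if there is no $x'\in A\setminus\{x\}$ with $x\twoheadrightarrow x'$, and $\hookrightarrow$-maximal in $A$ if there is no $x'\in A\setminus\{x\}$ with $x'\hookrightarrow x$. For $y\in S$, $T(y)=\{x'\in S: y\twoheadrightarrow x'\}$ and $F(y)=\{x'\in S: x'\hookrightarrow y\}$. The relation $\rightsquigarrow$ on $S$: $x\rightsquigarrow y$ iff either $x$ is $\twoheadrightarrow$-minimal in $F(y)$ or $x$ is $\hookrightarrow$-maximal in $T(y)$. A $\rightsquigarrow$-upset is a subset $C\subseteq S$ such that $x\rightsquigarrow y$ and $y\in C$ imply $x\in C$. For $x\to z$, an image of $x\to z$ is a $\twoheadrightarrow$-minimal element of $\{y\in S: x\twoheadrightarrow y\hookrightarrow z\}$, and a co-image of $x\to z$ is a $\hookrightarrow$-maximal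 element of this set. The image condition: for all $x,z\in S$ with $x\to z$ there is at least one image and at least one co-image of $x\to z$. A complete lattice homomorphism preserves joins and meets of arbitrary nonempty subsets. A congruence is an equivalence relation respecting finite nonempty meets and joins; it is complete if it respects arbitrary nonempty meets and joins. The congruence associated to a surjective (complete) homomorphism is the one whose classes are its fibers. A congruence $\Theta$ on a lattice $L$ is cover-determined if, whenever $x\le y$ and $u\equiv v\bmod\Theta$ for all $u,v$ with $x\le u\lessdot v\le y$ ($\lessdot$ denoting the cover relation), then $x\equiv y\bmod\Theta$. -}

module Defs where

open import Axiom.ExcludedMiddle using (ExcludedMiddle)
open import Data.Product using (Σ; ∃; _×_; _,_; proj₁; proj₂; swap)
open import Data.Sum using (_⊎_)
open import Data.Refinement using (Refinement; value)
open import Function using (_∘_; _on_; flip; id)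
open import Function.Definitions using (Congruent)
open import Level using (Level; Lift; lift; lower; suc; _⊔_)
open import Relation.Binary using (Rel; _⇔_; IsEquivalence; IsPartialOrder; Poset; Reflexive)
open import Relation.Binary.PropositionalEquality using (_≡_; _≢_)
open import Relation.Nullary using (¬_)
open import Relation.Nullary.Decidable using (True; toWitness; fromWitness)
open import Relation.Unary using (Pred; _∈_; _⊆_; _≐_)

-- Subsets are presented as families: a subset A is the family
-- proj₁ : ∃ A → Carrier. The level i bounds the size of the index types.

record CompleteLattice (c ℓ₁ ℓ₂ i : Level) : Set (suc (c ⊔ ℓ₁ ⊔ ℓ₂ ⊔ i)) where
  field
    poset : Poset c ℓ₁ ℓ₂

  open Poset poset public

  field
    ⋁       : {I : Set i} → (I → Carrier) → Carrier
    ⋀       : {I : Set i} → (I → Carrier) → Carrier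
    ⋁-upper : {I : Set i} (x : I → Carrier) → ∀ j → x j ≤ ⋁ x
    ⋁-least : {I : Set i} (x : I → Carrier) → ∀ z → (∀ j → x j ≤ z) → ⋁ x ≤ z
    ⋀-lower : {I : Set i} (x : I → Carrier) → ∀ j → ⋀ x ≤ x j
    ⋀-great : {I : Set i} (x : I → Carrier) → ∀ z → (∀ j → z ≤ x j) → z ≤ ⋀ x

module _ {c ℓ₁ ℓ₂ c′ ℓ₁′ ℓ₂′ i : Level}
         (L : CompleteLattice c ℓ₁ ℓ₂ i) (M : CompleteLattice c′ ℓ₁′ ℓ₂′ i) where

  private
    module L = CompleteLattice L
    module M = CompleteLattice M

  -- Only nonempty joins and meets are preserved: the argument of type I
  -- says that the family is nonempty.
  record IsCompleteLatticeHomomorphism (f : L.Carrier → M.Carrier)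
           : Set (c ⊔ ℓ₁ ⊔ ℓ₁′ ⊔ suc i) where
    field
      cong   : Congruent L._≈_ M._≈_ f
      ⋁-homo : {I : Set i} → I → (x : I → L.Carrier) → f (L.⋁ x) M.≈ M.⋁ (f ∘ x)
      ⋀-homo : {I : Set i} → I → (x : I → L.Carrier) → f (L.⋀ x) M.≈ M.⋀ (f ∘ x)

  Fibres : (L.Carrier → M.Carrier) → Rel L.Carrier ℓ₁′
  Fibres f = M._≈_ on f

module _ {c ℓ₁ ℓ₂ i : Level} (L : CompleteLattice c ℓ₁ ℓ₂ i) where

  open CompleteLattice L

  -- Finite nonempty joins and meets are the case of finite I, so a
  -- complete congruence is in particular a congruence.
  record IsCompleteCongruence {t : Level} (Θ : Rel Carrier t)
           : Set (c ⊔ ℓ₁ ⊔ t ⊔ suc i) where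
    field
      isEquivalence : IsEquivalence Θ
      reflexive     : ∀ {x y} → x ≈ y → Θ x y
      ⋁-cong : {I : Set i} → I → (x y : I → Carrier) →
               (∀ j → Θ (x j) (y j)) → Θ (⋁ x) (⋁ y)
      ⋀-cong : {I : Set i} → I → (x y : I → Carrier) →
               (∀ j → Θ (x j) (y j)) → Θ (⋀ x) (⋀ y)

  _<_ : Rel Carrier (ℓ₁ ⊔ ℓ₂)
  x < y = x ≤ y × ¬ (x ≈ y)

  _⋖_ : Rel Carrier (c ⊔ ℓ₁ ⊔ ℓ₂)
  x ⋖ y = x < y × ¬ (∃ λ z → x < z × z < y)

  CoverDetermined : {t : Level} → Rel Carrier t → Set (c ⊔ ℓ₁ ⊔ ℓ₂ ⊔ t)
  CoverDetermined Θ =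
    ∀ x y → x ≤ y → (∀ u v → x ≤ u → u ⋖ v → v ≤ y → Θ u v) → Θ x y

module _ {ℓ : Level} {S : Set ℓ} (_⟶_ : Rel S ℓ) where

  rightPerp : Pred S ℓ → Pred S ℓ
  rightPerp X y = ∀ x → x ∈ X → ¬ (x ⟶ y)

  leftPerp : Pred S ℓ → Pred S ℓ
  leftPerp X y = ∀ x → x ∈ X → ¬ (y ⟶ x)

  IsMaximalOrthogonalPair : Pred S ℓ → Pred S ℓ → Set ℓ
  IsMaximalOrthogonalPair X Y = Y ≐ rightPerp X × X ≐ leftPerp Y

  record Pair : Set (suc ℓ) where
    field
      X         : Pred S ℓ
      Y         : Pred S ℓ
      isMaximal : IsMaximalOrthogonalPair X Y

  open Pair

  pairsPoset : Poset (suc ℓ) ℓ ℓ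
  pairsPoset = record
    { Carrier = Pair
    ; _≈_     = λ p q → X p ≐ X q × Y p ≐ Y q
    ; _≤_     = λ p q → X p ⊆ X q
    ; isPartialOrder = record
      { isPreorder = record
        { isEquivalence = record
          { refl  = (id , id) , (id , id)
          ; sym   = λ (a , b) → swap a , swap b
          ; trans = λ ((a , a′) , (b , b′)) ((c , c′) , (d , d′)) →
              ((λ z → c (a z)) , (λ z → a′ (c′ z))) ,
              ((λ z → d (b z)) , (λ z → b′ (d′ z)))
          }
        ; reflexive = λ ((a , _) , _) → a
        ; trans     = λ f g z → g (f z)
        }
      ; antisym = λ {p} {q} f g → (f , g) , (Y-anti q p g , Y-anti p q f)
      }
    }
    where
    Y-anti : ∀ p q → X p ⊆ X q → Y q ⊆ Y p
    Y-anti p q f y∈ =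
      proj₂ (proj₁ (isMaximal p))
        (λ x x∈ → proj₁ (proj₁ (isMaximal q)) y∈ x (f x∈))

  module _ (em : ExcludedMiddle (suc ℓ)) where

    -- By excluded middle a proposition about Pair, which is a large type,
    -- is equivalent to a small one. This lets ⋁ and ⋀ range over families
    -- indexed by types in Set (suc ℓ), hence over every subset of Pair.
    Resize : Set (suc ℓ) → Set ℓ
    Resize P = Lift ℓ (True (em {P}))

    ⋂ : {I : Set (suc ℓ)} → (I → Pred S ℓ) → Pred S ℓ
    ⋂ A x = Resize (∀ j → x ∈ A j)

    private
      intro : {P : Set (suc ℓ)} → P → Resize P
      intro p = lift (fromWitness p)

      elim : {P : Set (suc ℓ)} → Resize P → P
      elim r = toWitness (lower r)

    join : {I : Set (suc ℓ)} → (I → Pair) → Pair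
    join p = record
      { X = leftPerp (⋂ (Y ∘ p))
      ; Y = ⋂ (Y ∘ p)
      ; isMaximal =
            ( (λ y∈ x x∈ → x∈ _ y∈)
            , (λ h → intro λ j → proj₂ (proj₁ (isMaximal (p j)))
                 λ x x∈ → h x λ y y∈ →
                   proj₁ (proj₁ (isMaximal (p j))) (elim y∈ j) x x∈) )
          , (id , id)
      }

    meet : {I : Set (suc ℓ)} → (I → Pair) → Pair
    meet p = record
      { X = ⋂ (X ∘ p)
      ; Y = rightPerp (⋂ (X ∘ p))
      ; isMaximal =
            (id , id)
          , ( (λ x∈ y y∈ → y∈ _ x∈)
            , (λ h → intro λ j → proj₂ (proj₂ (isMaximal (p j)))
                 λ y y∈ → h y λ x x∈ →
                   proj₁ (proj₂ (isMaximal (p j))) (elim x∈ j) y y∈) )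
      }

    Pairs : CompleteLattice (suc ℓ) ℓ ℓ (suc ℓ)
    Pairs = record
      { poset   = pairsPoset
      ; ⋁       = join
      ; ⋀       = meet
      ; ⋁-upper = λ p j x∈ y y∈ →
          proj₁ (proj₂ (isMaximal (p j))) x∈ y (elim y∈ j)
      ; ⋁-least = λ p z h x∈ → proj₂ (proj₂ (isMaximal z)) λ y y∈ →
          x∈ y (intro λ j → proj₂ (proj₁ (isMaximal (p j)))
            λ x′ x′∈ → proj₁ (proj₁ (isMaximal z)) y∈ x′ (h j x′∈))
      ; ⋀-lower = λ p j x∈ → elim x∈ j
      ; ⋀-great = λ p z h x∈ → intro λ j → h j x∈
      }

module _ {ℓ : Level} {S : Set ℓ} where

  Fact↠ : Rel S ℓ → Rel S ℓ
  Fact↠ _⟶_ x y = ∀ z → y ⟶ z → x ⟶ z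

  Fact↪ : Rel S ℓ → Rel S ℓ
  Fact↪ _⟶_ x y = ∀ z → z ⟶ x → z ⟶ y

  Mult : Rel S ℓ → Rel S ℓ → Rel S ℓ
  Mult _↠_ _↪_ x z = ∃ λ y → x ↠ y × y ↪ z

record Tuple (ℓ : Level) : Set (suc ℓ) where
  field
    S   : Set ℓ
    _⟶_ : Rel S ℓ
    _↠_ : Rel S ℓ
    _↪_ : Rel S ℓ

module _ {ℓ : Level} (𝓢 : Tuple ℓ) where

  open Tuple 𝓢

  record IsFactorizationSystem : Set ℓ where
    field
      ⟶-refl : Reflexive _⟶_
      fact↠  : Fact↠ _⟶_ ⇔ _↠_
      fact↪  : Fact↪ _⟶_ ⇔ _↪_
      mult   : Mult _↠_ _↪_ ⇔ _⟶_

  record TwoAcyclic : Set ℓ where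
    field
      ↠-acyclic  : ∀ x y → x ↠ y → y ↠ x → x ≡ y
      ↪-acyclic  : ∀ x y → x ↪ y → y ↪ x → x ≡ y
      ↠↪-acyclic : ∀ x y → x ↠ y → y ↪ x → x ≡ y

  -- Both x ↠ y and x ↪ y are read as "x is greater than or equal to y".

  ↠-MinimalIn : Pred S ℓ → Pred S ℓ
  ↠-MinimalIn A x = x ∈ A × ¬ (∃ λ x′ → x′ ∈ A × x′ ≢ x × x ↠ x′)

  ↪-MaximalIn : Pred S ℓ → Pred S ℓ
  ↪-MaximalIn A x = x ∈ A × ¬ (∃ λ x′ → x′ ∈ A × x′ ≢ x × x′ ↪ x)

  T : S → Pred S ℓ
  T y x′ = y ↠ x′

  F : S → Pred S ℓ
  F y x′ = x′ ↪ y

  _↝_ : Rel S ℓ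
  x ↝ y = ↠-MinimalIn (F y) x ⊎ ↪-MaximalIn (T y) x

  IsUpset : Pred S ℓ → Set ℓ
  IsUpset C = ∀ x y → x ↝ y → y ∈ C → x ∈ C

  Between : S → S → Pred S ℓ
  Between x z y = x ↠ y × y ↪ z

  IsImage : S → S → Pred S ℓ
  IsImage x z = ↠-MinimalIn (Between x z)

  IsCoimage : S → S → Pred S ℓ
  IsCoimage x z = ↪-MaximalIn (Between x z)

  ImageCondition : Set ℓ
  ImageCondition = ∀ x z → x ⟶ z → ∃ (IsImage x z) × ∃ (IsCoimage x z)

  -- The membership proof in Refinement is irrelevant, so elements of the
  -- restriction are equal exactly when their underlying elements of S are.
  restrict : Pred S ℓ → Tuple ℓ
  restrict C = record
    { S   = Refinement S C
    ; _⟶_ = _⟶_ on value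
    ; _↠_ = _↠_ on value
    ; _↪_ = _↪_ on value
    }

  -- X ∘ value is X ∩ C as a subset of C.
  RestrictsToPairs : Pred S ℓ → Set (suc ℓ)
  RestrictsToPairs C = (p : Pair _⟶_) →
    IsMaximalOrthogonalPair (Tuple._⟶_ (restrict C)) (Pair.X p ∘ value) (Pair.Y p ∘ value)

  restrictPair : (C : Pred S ℓ) → RestrictsToPairs C →
                 Pair _⟶_ → Pair (Tuple._⟶_ (restrict C))
  restrictPair C r p = record
    { X         = Pair.X p ∘ value
    ; Y         = Pair.Y p ∘ value
    ; isMaximal = r p
    }

PairsOf : {ℓ : Level} → ExcludedMiddle (suc ℓ) → Tuple ℓ →
          CompleteLattice (suc ℓ) ℓ ℓ (suc ℓ)
PairsOf em 𝓢 = Pairs (Tuple._⟶_ 𝓢) em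

{-# OPTIONS --safe #-}

-- The restriction to C is controlled by one observation: the image of x → z
-- is ↠-minimal in F z and its co-image is ↪-maximal in T x, so an upset
-- containing z (resp. x) contains the image (resp. co-image).
--
-- Each w generates a smallest pair J w with w ∈ X and a largest pair M w with
-- w ∈ Y; two-acyclicity makes J⁎ w = J w ∧ M w the largest pair strictly below
-- J w. If p ≤ q and w ∈ X q ∩ Y p, then v = p ∨ J w covers u = v ∧ M w inside
-- [p, q], which gives cover-determinedness. Conversely, a congruence Θ arises
-- from the set C of those w for which Θ does not contract the cover J⁎ w ⋖ J w.

module Submission where

open import Defs
open import Axiom.ExcludedMiddle using (ExcludedMiddle)
open import Data.Bool using (Bool; true; false; if_then_else_)
open import Data.Irrelevant using ([_]) renaming (map to map-irr)
open import Data.Product using (Σ-syntax; ∃-syntax; ∃; _×_; _,_; proj₁; proj₂)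
open import Data.Refinement using (value; proof) renaming (_,_ to _,ʳ_)
open import Data.Refinement.Properties using (value-injective)
open import Data.Sum using (inj₁; inj₂)
open import Function using (id; _∘_)
open import Function.Definitions using (Surjective)
open import Level using (Level; Lift; lift; lower; suc)
open import Relation.Binary using (Rel; _⇔_; IsEquivalence)
open import Relation.Binary.PropositionalEquality using (_≡_; _≢_; refl; sym; subst)
open import Relation.Nullary using (¬_; Dec; recompute)
open import Relation.Nullary.Decidable using (decidable-stable; map′; toWitness; fromWitness)
open import Relation.Unary using (Pred; _∈_; _∉_; _⊆_)

-- Binary meets and joins, and complete congruences.

module CompleteLatticeProperties {c ℓ₁ ℓ₂ i : Level} (L : CompleteLattice c ℓ₁ ℓ₂ i) where

  open CompleteLattice L public
    renaming (refl to ≤-refl; trans to ≤-trans; antisym to ≤-antisym; reflexive to ≤-reflexive)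

  infixr 7 _∧_
  infixr 6 _∨_

  private
    pair : Carrier → Carrier → Lift i Bool → Carrier
    pair x y b = if lower b then x else y

  _∧_ _∨_ : Carrier → Carrier → Carrier
  x ∧ y = ⋀ (pair x y)
  x ∨ y = ⋁ (pair x y)

  x∧y≤x : ∀ x y → x ∧ y ≤ x
  x∧y≤x x y = ⋀-lower (pair x y) (lift true)

  x∧y≤y : ∀ x y → x ∧ y ≤ y
  x∧y≤y x y = ⋀-lower (pair x y) (lift false)

  ∧-greatest : ∀ {x y z} → z ≤ x → z ≤ y → z ≤ x ∧ y
  ∧-greatest {x} {y} {z} a b = ⋀-great (pair x y) z λ where
    (lift true)  → a
    (lift false) → b

  x≤x∨y : ∀ x y → x ≤ x ∨ y
  x≤x∨y x y = ⋁-upper (pair x y) (lift true)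

  y≤x∨y : ∀ x y → y ≤ x ∨ y
  y≤x∨y x y = ⋁-upper (pair x y) (lift false)

  ∨-least : ∀ {x y z} → x ≤ z → y ≤ z → x ∨ y ≤ z
  ∨-least {x} {y} {z} a b = ⋁-least (pair x y) z λ where
    (lift true)  → a
    (lift false) → b

  x≤y⇒x∧y≈x : ∀ {x y} → x ≤ y → x ∧ y ≈ x
  x≤y⇒x∧y≈x x≤y = ≤-antisym (x∧y≤x _ _) (∧-greatest ≤-refl x≤y)

  x≤y⇒x∨y≈y : ∀ {x y} → x ≤ y → x ∨ y ≈ y
  x≤y⇒x∨y≈y x≤y = ≤-antisym (∨-least x≤y ≤-refl) (y≤x∨y _ _)

  y≤x⇒x∨y≈x : ∀ {x y} → y ≤ x → x ∨ y ≈ x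
  y≤x⇒x∨y≈x y≤x = ≤-antisym (∨-least ≤-refl y≤x) (x≤x∨y _ _)

  ⋁-mono : {I : Set i} {x y : I → Carrier} → (∀ j → x j ≤ y j) → ⋁ x ≤ ⋁ y
  ⋁-mono {y = y} h = ⋁-least _ _ λ j → ≤-trans (h j) (⋁-upper y j)

  ⋀-mono : {I : Set i} {x y : I → Carrier} → (∀ j → x j ≤ y j) → ⋀ x ≤ ⋀ y
  ⋀-mono {x = x} h = ⋀-great _ _ λ j → ≤-trans (⋀-lower x j) (h j)

  ⋁-resp-≈ : {I : Set i} {x y : I → Carrier} → (∀ j → x j ≈ y j) → ⋁ x ≈ ⋁ y
  ⋁-resp-≈ h = ≤-antisym (⋁-mono (≤-reflexive ∘ h)) (⋁-mono (≤-reflexive ∘ Eq.sym ∘ h))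

  ⋀-resp-≈ : {I : Set i} {x y : I → Carrier} → (∀ j → x j ≈ y j) → ⋀ x ≈ ⋀ y
  ⋀-resp-≈ h = ≤-antisym (⋀-mono (≤-reflexive ∘ h)) (⋀-mono (≤-reflexive ∘ Eq.sym ∘ h))

  module Congruence {t : Level} {Θ : Rel Carrier t} (Θ-cong : IsCompleteCongruence L Θ) where

    open IsCompleteCongruence Θ-cong public using (⋁-cong; ⋀-cong)
      renaming (reflexive to Θ-reflexive)
    open IsEquivalence (IsCompleteCongruence.isEquivalence Θ-cong) public using ()
      renaming (refl to Θ-refl; sym to Θ-sym; trans to Θ-trans)

    Θ-resp-≈ : ∀ {x x′ y y′} → x ≈ x′ → y ≈ y′ → Θ x y → Θ x′ y′
    Θ-resp-≈ x≈x′ y≈y′ xΘy = Θ-trans (Θ-reflexive (Eq.sym x≈x′)) (Θ-trans xΘy (Θ-reflexive y≈y′))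

    ∧-cong : ∀ {x x′ y y′} → Θ x x′ → Θ y y′ → Θ (x ∧ y) (x′ ∧ y′)
    ∧-cong a b = ⋀-cong (lift true) _ _ λ where
      (lift true)  → a
      (lift false) → b

    ∨-cong : ∀ {x x′ y y′} → Θ x x′ → Θ y y′ → Θ (x ∨ y) (x′ ∨ y′)
    ∨-cong a b = ⋁-cong (lift true) _ _ λ where
      (lift true)  → a
      (lift false) → b

    -- Joining `y` to both sides of `Θ x z` leaves `y` on the left and `z` on the right.
    Θ-convex : ∀ {x y z} → x ≤ y → y ≤ z → Θ x z → Θ y z
    Θ-convex x≤y y≤z xΘz =
      Θ-resp-≈ (x≤y⇒x∨y≈y x≤y) (y≤x⇒x∨y≈x y≤z) (∨-cong xΘz Θ-refl)

    Θ-∧ˡ : ∀ {x y} → Θ x y → Θ (x ∧ y) x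
    Θ-∧ˡ xΘy = Θ-resp-≈ Eq.refl (x≤y⇒x∧y≈x ≤-refl) (∧-cong Θ-refl (Θ-sym xΘy))

    Θ-∧ʳ : ∀ {x y} → Θ x y → Θ (x ∧ y) y
    Θ-∧ʳ xΘy = Θ-resp-≈ Eq.refl (x≤y⇒x∧y≈x ≤-refl) (∧-cong xΘy Θ-refl)

  -- A congruence is determined by its comparable pairs: related `x` and `y` are both related to
  -- `x ∧ y`.
  congruence-⊆ : ∀ {t t′} {Θ : Rel Carrier t} {Ψ : Rel Carrier t′} →
    IsCompleteCongruence L Θ → IsCompleteCongruence L Ψ →
    (∀ {x y} → x ≤ y → Θ x y → Ψ x y) → ∀ {x y} → Θ x y → Ψ x y
  congruence-⊆ Θ-cong Ψ-cong h xΘy =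
    Ψ.Θ-trans (Ψ.Θ-sym (h (x∧y≤x _ _) (Θ.Θ-∧ˡ xΘy))) (h (x∧y≤y _ _) (Θ.Θ-∧ʳ xΘy))
    where
    module Θ = Congruence Θ-cong
    module Ψ = Congruence Ψ-cong

module _ {c ℓ₁ ℓ₂ c′ ℓ₁′ ℓ₂′ i : Level}
         (L : CompleteLattice c ℓ₁ ℓ₂ i) (M : CompleteLattice c′ ℓ₁′ ℓ₂′ i) where

  private
    module L = CompleteLattice L
    module M = CompleteLatticeProperties M

  Fibres-isCompleteCongruence : ∀ {f} → IsCompleteLatticeHomomorphism L M f →
    IsCompleteCongruence L (Fibres L M f)
  Fibres-isCompleteCongruence {f} f-hom = record
    { isEquivalence = record { refl = M.Eq.refl ; sym = M.Eq.sym ; trans = M.Eq.trans }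
    ; reflexive     = f.cong
    ; ⋁-cong        = λ i x y h →
        M.Eq.trans (f.⋁-homo i x) (M.Eq.trans (M.⋁-resp-≈ h) (M.Eq.sym (f.⋁-homo i y)))
    ; ⋀-cong        = λ i x y h →
        M.Eq.trans (f.⋀-homo i x) (M.Eq.trans (M.⋀-resp-≈ h) (M.Eq.sym (f.⋀-homo i y)))
    }
    where module f = IsCompleteLatticeHomomorphism f-hom

-- Maximal orthogonal pairs of a relation.

module PairProperties {ℓ : Level} {S : Set ℓ} {_⟶_ : Rel S ℓ} where

  open Pair

  ⟶-disjoint : (p : Pair _⟶_) → ∀ {x y} → x ∈ X p → y ∈ Y p → ¬ (x ⟶ y)
  ⟶-disjoint p x∈ y∈ = proj₁ (proj₁ (isMaximal p)) y∈ _ x∈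

  X-complete : (p : Pair _⟶_) → leftPerp _⟶_ (Y p) ⊆ X p
  X-complete p = proj₂ (proj₂ (isMaximal p))

  Y-complete : (p : Pair _⟶_) → rightPerp _⟶_ (X p) ⊆ Y p
  Y-complete p = proj₂ (proj₁ (isMaximal p))

  Y-antitone : (p q : Pair _⟶_) → X p ⊆ X q → Y q ⊆ Y p
  Y-antitone p q p≤q y∈ = Y-complete p λ x x∈ → ⟶-disjoint q (p≤q x∈) y∈

  X-antitone : (p q : Pair _⟶_) → Y p ⊆ Y q → X q ⊆ X p
  X-antitone p q Yp⊆Yq x∈ = X-complete p λ y y∈ → ⟶-disjoint q x∈ (Yp⊆Yq y∈)

  J : S → Pair _⟶_
  J w = record
    { X         = leftPerp _⟶_ (λ y → ¬ (w ⟶ y))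
    ; Y         = λ y → ¬ (w ⟶ y)
    ; isMaximal = ((λ y∈ x x∈ → x∈ _ y∈) , (λ h → h w λ y y∈ → y∈)) , (id , id)
    }

  M : S → Pair _⟶_
  M w = record
    { X         = λ x → ¬ (x ⟶ w)
    ; Y         = rightPerp _⟶_ (λ x → ¬ (x ⟶ w))
    ; isMaximal = (id , id) , ((λ x∈ y y∈ → y∈ _ x∈) , (λ h → h w λ x x∈ → x∈))
    }

  w∈XJ : ∀ w → w ∈ X (J w)
  w∈XJ w y y∈ = y∈

  J-least : (p : Pair _⟶_) → ∀ {w} → w ∈ X p → X (J w) ⊆ X p
  J-least p w∈ = X-antitone p (J _) λ y∈ → ⟶-disjoint p w∈ y∈

  M-greatest : (p : Pair _⟶_) → ∀ {w} → w ∈ Y p → X p ⊆ X (M w)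
  M-greatest p w∈ x∈ = ⟶-disjoint p x∈ w∈

  M-greatest⁻¹ : (p : Pair _⟶_) → ∀ {w} → X p ⊆ X (M w) → w ∈ Y p
  M-greatest⁻¹ p p≤M = Y-complete p λ x x∈ → p≤M x∈

-- Arrows and orthogonal pairs in a factorization system.

module FactorizationSystem {ℓ : Level} (em : ExcludedMiddle (suc ℓ)) (𝓢 : Tuple ℓ)
  (fs : IsFactorizationSystem 𝓢) where

  open Tuple 𝓢
  open IsFactorizationSystem fs
  open Pair
  open PairProperties {_⟶_ = _⟶_}
  open CompleteLatticeProperties (PairsOf em 𝓢)

  decide : (P : Set ℓ) → Dec P
  decide P = map′ lower lift (em {Lift (suc ℓ) P})

  ⟶-stable : ∀ {x y} → ¬ ¬ (x ⟶ y) → x ⟶ y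
  ⟶-stable = decidable-stable (decide _)

  ↠-⟶-trans : ∀ {x y z} → x ↠ y → y ⟶ z → x ⟶ z
  ↠-⟶-trans x↠y = proj₂ fact↠ x↠y _

  ⟶-↪-trans : ∀ {x y z} → x ⟶ y → y ↪ z → x ⟶ z
  ⟶-↪-trans x⟶y y↪z = proj₂ fact↪ y↪z _ x⟶y

  ↠-trans : ∀ {x y z} → x ↠ y → y ↠ z → x ↠ z
  ↠-trans x↠y y↠z = proj₁ fact↠ λ _ → ↠-⟶-trans x↠y ∘ ↠-⟶-trans y↠z

  ↪-trans : ∀ {x y z} → x ↪ y → y ↪ z → x ↪ z
  ↪-trans x↪y y↪z = proj₁ fact↪ λ _ w⟶x → ⟶-↪-trans (⟶-↪-trans w⟶x x↪y) y↪z

  ↠⇒⟶ : ∀ {x y} → x ↠ y → x ⟶ y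
  ↠⇒⟶ x↠y = ↠-⟶-trans x↠y ⟶-refl

  ↪⇒⟶ : ∀ {x y} → x ↪ y → x ⟶ y
  ↪⇒⟶ x↪y = ⟶-↪-trans ⟶-refl x↪y

  X-closed : (p : Pair _⟶_) → ∀ {x y} → x ∈ X p → x ↠ y → y ∈ X p
  X-closed p x∈ x↠y = X-complete p λ z z∈ y⟶z → ⟶-disjoint p x∈ z∈ (↠-⟶-trans x↠y y⟶z)

  Y-closed : (p : Pair _⟶_) → ∀ {x y} → x ↪ y → y ∈ Y p → x ∈ Y p
  Y-closed p x↪y y∈ = Y-complete p λ z z∈ z⟶x → ⟶-disjoint p z∈ y∈ (⟶-↪-trans z⟶x x↪y)

  XJ⇒↠ : ∀ {w x} → x ∈ X (J w) → w ↠ x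
  XJ⇒↠ x∈ = proj₁ fact↠ λ z x⟶z → ⟶-stable λ ¬w⟶z → x∈ z ¬w⟶z x⟶z

  YM⇒↪ : ∀ {w y} → y ∈ Y (M w) → y ↪ w
  YM⇒↪ y∈ = proj₁ fact↪ λ z z⟶y → ⟶-stable λ ¬z⟶w → y∈ z ¬z⟶w z⟶y

  w∉XM : ∀ w → w ∉ X (M w)
  w∉XM w ¬w⟶w = ¬w⟶w ⟶-refl

  -- A `y` with `w ↠ y` inherits `x ↠ y` by transitivity, so a competitor in `F z` is already one in
  -- `Between x z`.
  image⇒↝ : ∀ {x z w} → IsImage 𝓢 x z w → _↝_ 𝓢 w z
  image⇒↝ ((x↠w , w↪z) , minimal) = inj₁ (w↪z , λ (y , y↪z , y≢w , w↠y) →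
    minimal (y , (↠-trans x↠w w↠y , y↪z) , y≢w , w↠y))

  coimage⇒↝ : ∀ {x z w} → IsCoimage 𝓢 x z w → _↝_ 𝓢 w x
  coimage⇒↝ ((x↠w , w↪z) , maximal) = inj₂ (x↠w , λ (y , x↠y , y≢w , y↪w) →
    maximal (y , (x↠y , ↪-trans y↪w w↪z) , y≢w , y↪w))

  -- An `x` in `X q` outside `X p` has an arrow to some `y` in `Y p`; the middle term of its
  -- factorization lies in `X q` and `Y p` by closure.
  ≰⇒separated : (p q : Pair _⟶_) → ¬ (X q ⊆ X p) → ¬ ¬ (∃ λ w → w ∈ X q × w ∈ Y p)
  ≰⇒separated p q q≰p none = q≰p λ x∈ → X-complete p λ y y∈ x⟶y →
    let w , x↠w , w↪y = proj₂ mult x⟶y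
    in none (w , X-closed q x∈ x↠w , Y-closed p w↪y y∈)

  J⁎ : S → Pair _⟶_
  J⁎ w = J w ∧ M w

  Y-∨ : (p q : Pair _⟶_) → ∀ {y} → y ∈ Y p → y ∈ Y q → y ∈ Y (p ∨ q)
  Y-∨ p q y∈p y∈q =
    M-greatest⁻¹ (p ∨ q) (∨-least {p} {q} {M _} (M-greatest p y∈p) (M-greatest q y∈q))

  Y-∨⁻ˡ : (p q : Pair _⟶_) → Y (p ∨ q) ⊆ Y p
  Y-∨⁻ˡ p q = Y-antitone p (p ∨ q) (x≤x∨y p q)

  Y-∨⁻ʳ : (p q : Pair _⟶_) → Y (p ∨ q) ⊆ Y q
  Y-∨⁻ʳ p q = Y-antitone q (p ∨ q) (y≤x∨y p q)

  -- Two-acyclicity and covers.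

  module Acyclic (acyclic : TwoAcyclic 𝓢) where

    open TwoAcyclic acyclic

    -- Factoring as `x ↠ z ↪ y` gives `x ↠ z ↪ x`, so `z` is `x`; antisymmetry of `↪` does the rest.
    ⟶-↪-acyclic : ∀ {x y} → x ⟶ y → y ↪ x → x ≡ y
    ⟶-↪-acyclic x⟶y y↪x with proj₂ mult x⟶y
    ... | z , x↠z , z↪y with ↠↪-acyclic _ z x↠z (↪-trans z↪y y↪x)
    ... | refl = ↪-acyclic _ _ z↪y y↪x

    -- `u` keeps the elements of `v` without an arrow to `w`. A `z` in `[u, v]` other than `u`
    -- contains some `x` with `x ⟶ w`, hence also the middle term, which `absorbs` identifies with
    -- `w`; so `z` contains `J w` and equals `v`.
    cover-between : (p q : Pair _⟶_) → p ≤ q → ∀ {w} → w ∈ X q → w ∈ Y p →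
      ∃[ u ] ∃[ v ] p ≤ u × _⋖_ (PairsOf em 𝓢) u v × v ≤ q × w ∈ X v × w ∉ X u
    cover-between p q p≤q {w} w∈q w∈p =
      u , v , p≤u , ((u≤v , λ u≈v → w∉u (proj₂ (proj₁ u≈v) w∈v)) , no-between) ,
      ∨-least {p} {J w} {q} p≤q (J-least q w∈q) , w∈v , w∉u
      where
      v = p ∨ J w
      u = v ∧ M w
      u≤v : u ≤ v
      u≤v = x∧y≤x v (M w)
      p≤u : p ≤ u
      p≤u = ∧-greatest {v} {M w} {p} (x≤x∨y p (J w)) (M-greatest p w∈p)
      w∈v : w ∈ X v
      w∈v = y≤x∨y p (J w) (w∈XJ w)
      w∉u : w ∉ X u
      w∉u w∈u = w∉XM w (x∧y≤y v (M w) w∈u)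

      -- If w ⟶ x fails, then x lies in both X v and Y v, against x ⟶ x.
      absorbs : ∀ {x} → x ∈ X v → x ↪ w → ¬ (x ≢ w)
      absorbs x∈v x↪w x≢w = ⟶-disjoint v x∈v
        (Y-∨ p (J w) (Y-closed p x↪w w∈p) λ w⟶x →
          x≢w (sym (⟶-↪-acyclic w⟶x x↪w)))
        ⟶-refl

      no-between : ¬ (∃ λ z → _<_ (PairsOf em 𝓢) u z × _<_ (PairsOf em 𝓢) z v)
      no-between (z , (u≤z , u≉z) , (z≤v , z≉v)) =
        u≉z (≤-antisym {u} {z} u≤z (∧-greatest {v} {M w} {z} z≤v λ x∈z x⟶w →
          let y , x↠y , y↪w = proj₂ mult x⟶w
              y∈z = X-closed z x∈z x↠y
          in absorbs (z≤v y∈z) y↪w λ y≡w →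
            z≉v (≤-antisym {z} {v} z≤v
              (∨-least {p} {J w} {z} (u≤z ∘ p≤u) (J-least z (subst (X z) y≡w y∈z))))))

  -- Restriction to an upset.

  module Restriction (image : ImageCondition 𝓢) (C : Pred S ℓ) (up : IsUpset 𝓢 C) where

    private
      𝓒 = restrict 𝓢 C
      module 𝓒 = Tuple 𝓒

    imageᶜ : ∀ {x} (z : 𝓒.S) → x ⟶ value z →
      Σ[ w ∈ 𝓒.S ] IsImage 𝓢 x (value z) (value w)
    imageᶜ z x⟶z with proj₁ (image _ _ x⟶z)
    ... | w , w-image = (w ,ʳ map-irr (up w _ (image⇒↝ w-image)) (proof z)) , w-image

    coimageᶜ : ∀ (x : 𝓒.S) {z} → value x ⟶ z →
      Σ[ w ∈ 𝓒.S ] IsCoimage 𝓢 (value x) z (value w)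
    coimageᶜ x x⟶z with proj₂ (image _ _ x⟶z)
    ... | w , w-coimage = (w ,ʳ map-irr (up w _ (coimage⇒↝ w-coimage)) (proof x)) , w-coimage

    -- `Fact↠` over `C` tests only targets in `C`. A general `y ⟶ z` passes through its co-image `w`
    -- in `C`, and `x ⟶ w ↪ z` gives `x ⟶ z`. Images serve `Fact↪` dually.
    isFactorizationSystem : IsFactorizationSystem 𝓒
    isFactorizationSystem = record
      { ⟶-refl = ⟶-refl
      ; fact↠  = (λ {_} {y} h → proj₁ fact↠ λ z y⟶z →
                    let w , (y↠w , w↪z) , _ = coimageᶜ y y⟶z
                    in ⟶-↪-trans (h w (↠⇒⟶ y↠w)) w↪z)
                , (λ x↠y z → ↠-⟶-trans x↠y)
      ; fact↪  = (λ {x} h → proj₁ fact↪ λ z z⟶x →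
                    let w , (z↠w , w↪x) , _ = imageᶜ x z⟶x
                    in ↠-⟶-trans z↠w (h w (↪⇒⟶ w↪x)))
                , (λ x↪y z z⟶x → ⟶-↪-trans z⟶x x↪y)
      ; mult   = (λ (y , x↠y , y↪z) → ⟶-↪-trans (↠⇒⟶ x↠y) y↪z)
                , (λ {_} {z} x⟶z → let w , between , _ = imageᶜ z x⟶z in w , between)
      }

    twoAcyclic : TwoAcyclic 𝓢 → TwoAcyclic 𝓒
    twoAcyclic acyclic = record
      { ↠-acyclic  = λ x y a b → value-injective (↠-acyclic _ _ a b)
      ; ↪-acyclic  = λ x y a b → value-injective (↪-acyclic _ _ a b)
      ; ↠↪-acyclic = λ x y a b → value-injective (↠↪-acyclic _ _ a b)
      }
      where open TwoAcyclic acyclic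

    imageCondition : ImageCondition 𝓒
    imageCondition x z x⟶z with imageᶜ z x⟶z | coimageᶜ x x⟶z
    ... | w , between , minimal | w′ , between′ , maximal =
      (w , between , λ (y , y∈ , y≢w , w↠y) →
        minimal (value y , y∈ , y≢w ∘ value-injective , w↠y)) ,
      (w′ , between′ , λ (y , y∈ , y≢w′ , y↪w′) →
        maximal (value y , y∈ , y≢w′ ∘ value-injective , y↪w′))

    -- If `x ⟶ y` with `x` in `X p` and `y` in `C`, the image lies in `X p ∩ C` and still has an
    -- arrow to `y`; so orthogonality to `X p ∩ C` gives orthogonality to `X p`. Co-images give the
    -- other half.
    restrictsToPairs : RestrictsToPairs 𝓢 C
    restrictsToPairs p =
      ( (λ y∈ x x∈ → ⟶-disjoint p x∈ y∈)
      , (λ {y} h → Y-complete p λ x x∈ x⟶y →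
          let w , (x↠w , w↪y) , _ = imageᶜ y x⟶y
          in h w (X-closed p x∈ x↠w) (↪⇒⟶ w↪y)) ) ,
      ( (λ x∈ y y∈ → ⟶-disjoint p x∈ y∈)
      , (λ {x} h → X-complete p λ y y∈ x⟶y →
          let w , (x↠w , w↪y) , _ = coimageᶜ x x⟶y
          in h w (Y-closed p w↪y y∈) (↠⇒⟶ x↠w)) )

    private
      π : Pair _⟶_ → Pair 𝓒._⟶_
      π = restrictPair 𝓢 C restrictsToPairs
      module PC = PairProperties {_⟶_ = 𝓒._⟶_}
      module LC = CompleteLatticeProperties (PairsOf em 𝓒)

    _≈π_ : Rel (Pair _⟶_) ℓ
    _≈π_ = Fibres (PairsOf em 𝓢) (PairsOf em 𝓒) π

    ≈π-intro : (p q : Pair _⟶_) → p ≤ q → (∀ (x : 𝓒.S) → value x ∈ X q → value x ∈ X p) →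
      p ≈π q
    ≈π-intro p q p≤q h = LC.≤-antisym {π p} {π q} p≤q λ {x} → h x

    surjective : Surjective _≈_ LC._≈_ π
    surjective r = p , λ {q} ((q≤p , p≤q) , _) → LC.Eq.trans {π q} {π p} {r}
      (LC.≤-antisym {π q} {π p} q≤p p≤q)
      (LC.≤-antisym {π p} {r}
        (λ {x} x∈p → PC.X-complete r λ y y∈r →
          x∈p (value y) λ x′ x′∈r → PC.⟶-disjoint r x′∈r y∈r)
        (λ {x} x∈r y y∈ → y∈ x x∈r))
      where
      -- The perp of `X r` taken in all of `S`; within `C` it is `Y r`.
      Y₀ : Pred S ℓ
      Y₀ y = ∀ (x : 𝓒.S) → x ∈ X r → ¬ (value x ⟶ y)
      p : Pair _⟶_
      p = record
        { X         = leftPerp _⟶_ Y₀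
        ; Y         = Y₀
        ; isMaximal = ( (λ y∈ x x∈ → x∈ _ y∈)
                      , (λ h x x∈r → h (value x) λ y y∈ → y∈ x x∈r) ) , (id , id)
        }

    -- Joins intersect second components, meets intersect first components, and intersection
    -- commutes with restriction; hence each `id`.
    isCompleteLatticeHomomorphism :
      IsCompleteLatticeHomomorphism (PairsOf em 𝓢) (PairsOf em 𝓒) π
    isCompleteLatticeHomomorphism = record
      { cong   = λ {p} {q} ((p≤q , q≤p) , _) → LC.≤-antisym {π p} {π q} p≤q q≤p
      ; ⋁-homo = λ _ p → LC.≤-antisym {π (⋁ p)} {LC.⋁ (π ∘ p)}
          (λ {x} → PC.X-antitone (LC.⋁ (π ∘ p)) (π (⋁ p)) id {x})
          (λ {x} → PC.X-antitone (π (⋁ p)) (LC.⋁ (π ∘ p)) id {x})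
      ; ⋀-homo = λ _ p → LC.≤-antisym {π (⋀ p)} {LC.⋀ (π ∘ p)} id id
      }

    isCompleteCongruence : IsCompleteCongruence (PairsOf em 𝓢) _≈π_
    isCompleteCongruence = Fibres-isCompleteCongruence _ _ isCompleteLatticeHomomorphism

    -- A `c` in `X q ∩ C` outside `X p` has an arrow to some `y` in `Y p`. The co-image `w` lies in
    -- `C`, `X q` and `Y p`, so some cover in `[p, q]` is separated by `w` and cannot be contracted.
    coverDetermined : TwoAcyclic 𝓢 → CoverDetermined (PairsOf em 𝓢) _≈π_
    coverDetermined acyclic p q p≤q h = ≈π-intro p q p≤q λ c c∈q →
      X-complete p λ y y∈p c⟶y →
        let w , (c↠w , w↪y) , _ = coimageᶜ c c⟶y
            u , v , p≤u , u⋖v , v≤q , w∈v , w∉u = Acyclic.cover-between acyclic p q p≤q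
              (X-closed q c∈q c↠w) (Y-closed p w↪y y∈p)
        in w∉u (proj₂ (proj₁ (h u v p≤u u⋖v v≤q)) {w} w∈v)

  -- The upset of a complete congruence.

  module FromCongruence (acyclic : TwoAcyclic 𝓢) (image : ImageCondition 𝓢)
    {Θ : Rel (Pair _⟶_) (suc ℓ)} (Θ-cong : IsCompleteCongruence (PairsOf em 𝓢) Θ) where

    open TwoAcyclic acyclic
    open Congruence Θ-cong

    Contracted : S → Set (suc ℓ)
    Contracted w = Θ (J⁎ w) (J w)

    -- `Contracted` lives at level `suc ℓ`, while subsets of `S` have level `ℓ`; hence `Resize`.
    Uncontracted : Pred S ℓ
    Uncontracted w = Resize _⟶_ em (¬ Contracted w)

    -- Meeting `Θ p q` with `J w` relates `J w ∧ p` to `J w`, and `J⁎ w` lies between them.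
    separated⇒contracted : (p q : Pair _⟶_) → Θ p q → ∀ {w} → w ∈ X q → w ∉ X p →
      Contracted w
    separated⇒contracted p q pΘq {w} w∈q w∉p =
      Θ-convex {J w ∧ p} {J⁎ w} {J w}
        (∧-greatest {J w} {M w} {J w ∧ p} (x∧y≤x (J w) p) λ x∈ x⟶w →
          -- Here `w ↠ y ↪ w`, so `y` is `w`, which would then lie in `X p`.
          let y , x↠y , y↪w = proj₂ mult x⟶w
              y∈J = X-closed (J w) (x∧y≤x (J w) p x∈) x↠y
              y∈p = X-closed p (x∧y≤y (J w) p x∈) x↠y
          in w∉p (subst (X p) (sym (↠↪-acyclic w y (XJ⇒↠ y∈J) y↪w)) y∈p))
        (x∧y≤x (J w) (M w))
        (Θ-resp-≈ {J w ∧ p} {J w ∧ p} {J w ∧ q} {J w} (Eq.refl {J w ∧ p})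
          (x≤y⇒x∧y≈x {J w} {q} (J-least q w∈q))
          (∧-cong {J w} {J w} {p} {q} Θ-refl pΘq))

    contracted⇒Θ-∨ : (p : Pair _⟶_) → ∀ {w} → X (J⁎ w) ⊆ X p → Contracted w →
      Θ p (p ∨ J w)
    contracted⇒Θ-∨ p {w} J⁎≤p c = Θ-resp-≈ {p ∨ J⁎ w} {p} {p ∨ J w} {p ∨ J w}
      (y≤x⇒x∨y≈x {p} {J⁎ w} J⁎≤p) (Eq.refl {p ∨ J w})
      (∨-cong {p} {p} {J⁎ w} {J w} Θ-refl c)

    -- M y (resp. M x) and its join with J x are identified once x is contracted,
    -- and only the join contains y.
    contracted-↝ : ∀ {x y} → _↝_ 𝓢 x y → Contracted x → Contracted y
    contracted-↝ {x} {y} (inj₁ (x↪y , minimal)) c =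
      separated⇒contracted (M y) (M y ∨ J x)
        -- `J⁎ x ≤ M y`: an `a` in `X (J⁎ x)` with `a ⟶ y` factors through some `b` in `F y` with
        -- `x ↠ b`. As `a ⟶ x` fails, `b` is not `x`, against minimality of `x`.
        (contracted⇒Θ-∨ (M y) (λ {a} a∈ a⟶y →
          let b , a↠b , b↪y = proj₂ mult a⟶y
              x↠a = XJ⇒↠ (x∧y≤x (J x) (M x) a∈)
          in minimal (b , b↪y ,
               (λ b≡x → x∧y≤y (J x) (M x) a∈ (subst (a ⟶_) b≡x (↠⇒⟶ a↠b))) , ↠-trans x↠a a↠b)) c)
        (X-complete (M y ∨ J x) λ z z∈ y⟶z →
          Y-∨⁻ʳ (M y) (J x) z∈
            (↪⇒⟶ (subst (x ↪_) (Acyclic.⟶-↪-acyclic acyclic y⟶z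
              (YM⇒↪ (Y-∨⁻ˡ (M y) (J x) z∈))) x↪y)))
        (w∉XM y)
    contracted-↝ {x} {y} (inj₂ (y↠x , maximal)) c =
      separated⇒contracted (M x) (M x ∨ J x)
        (contracted⇒Θ-∨ (M x) (x∧y≤y (J x) (M x)) c)
        -- Factor as `y ↠ w ↪ z`, where `z ↪ x`. As `x ⟶ z` fails, `w` is not `x`, against
        -- maximality of `x` in `T y`.
        (X-complete (M x ∨ J x) λ z z∈ y⟶z →
          let w , y↠w , w↪z = proj₂ mult y⟶z
              z↪x = YM⇒↪ (Y-∨⁻ˡ (M x) (J x) z∈)
          in maximal (w , y↠w ,
               (λ w≡x → Y-∨⁻ʳ (M x) (J x) z∈ (↪⇒⟶ (subst (_↪ z) w≡x w↪z))) , ↪-trans w↪z z↪x))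
        (λ ¬y⟶x → ¬y⟶x (↠⇒⟶ y↠x))

    uncontracted-isUpset : IsUpset 𝓢 Uncontracted
    uncontracted-isUpset x y x↝y y∈C = lift (fromWitness λ x-contracted →
      toWitness (lower y∈C) (contracted-↝ x↝y x-contracted))

    -- Both `u ∨ J⁎ w` and `u ∨ J w` lie in `[u, v]`, so each is `u` or `v`. The first has `w` in
    -- its `Y` and is `u`; the second has `w` in its `X` and is `v`. Contraction of `w` relates
    -- them.
    contracted⇒Θ-cover : (u v : Pair _⟶_) → _⋖_ (PairsOf em 𝓢) u v →
      ∀ {w} → w ∈ X v → w ∈ Y u → Contracted w → Θ u v
    contracted⇒Θ-cover u v ((u≤v , _) , no-between) {w} w∈v w∈u c =
      Θ-resp-≈ {u ∨ J⁎ w} {u} {u ∨ J w} {v}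
        (Eq.sym {u} {u ∨ J⁎ w} (decidable-stable (decide (u ≈ u ∨ J⁎ w)) λ u≉z →
          let z≈v = fills (u ∨ J⁎ w) (x≤x∨y u (J⁎ w))
                (∨-least {u} {J⁎ w} {v} u≤v (J-least v w∈v ∘ x∧y≤x (J w) (M w))) u≉z
              w∈Yz = Y-∨ u (J⁎ w) w∈u (M-greatest⁻¹ (J⁎ w) (x∧y≤y (J w) (M w)))
          in ⟶-disjoint (u ∨ J⁎ w) (proj₂ (proj₁ z≈v) w∈v) w∈Yz ⟶-refl))
        (fills (u ∨ J w) (x≤x∨y u (J w)) (∨-least {u} {J w} {v} u≤v (J-least v w∈v))
          λ u≈z → ⟶-disjoint u (proj₂ (proj₁ u≈z) (y≤x∨y u (J w) (w∈XJ w))) w∈u ⟶-refl)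
        (∨-cong {u} {u} {J⁎ w} {J w} Θ-refl c)
      where
      fills : ∀ z → u ≤ z → z ≤ v → ¬ (u ≈ z) → z ≈ v
      fills z u≤z z≤v u≉z = decidable-stable (decide (z ≈ v)) λ z≉v →
        no-between (z , (u≤z , u≉z) , (z≤v , z≉v))

    open Restriction image Uncontracted uncontracted-isUpset
      using (_≈π_; ≈π-intro; isCompleteCongruence)

    Θ⇒≈π : (p q : Pair _⟶_) → p ≤ q → Θ p q → p ≈π q
    Θ⇒≈π p q p≤q pΘq = ≈π-intro p q p≤q λ (c ,ʳ [ c∈C ]) c∈q →
      decidable-stable (decide (c ∈ X p)) λ c∉p →
        toWitness (lower (recompute (decide (c ∈ Uncontracted)) c∈C))
          (separated⇒contracted p q pΘq c∈q c∉p)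

    -- It suffices to treat covers `u ⋖ v` in `[p, q]`, each separated by some `w`. Were `w`
    -- uncontracted, `p ≈π q` would put it in `X p`, while `Y u ⊆ Y p` puts it in `Y p`, against
    -- `w ⟶ w`.
    ≈π⇒Θ : CoverDetermined (PairsOf em 𝓢) Θ → (p q : Pair _⟶_) → p ≤ q → p ≈π q → Θ p q
    ≈π⇒Θ Θ-cover-determined p q p≤q p≈q = Θ-cover-determined p q p≤q λ u v p≤u u⋖v v≤q →
      decidable-stable em λ ¬uΘv →
        ≰⇒separated u v (λ v≤u → proj₂ (proj₁ u⋖v) (≤-antisym {u} {v} (proj₁ (proj₁ u⋖v)) v≤u))
          λ (w , w∈v , w∈u) →
            ¬uΘv (contracted⇒Θ-cover u v u⋖v w∈v w∈u (decidable-stable em λ w-uncontracted →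
              ⟶-disjoint p
                (proj₂ (proj₁ p≈q) {w ,ʳ [ lift (fromWitness w-uncontracted) ]} (v≤q w∈v))
                (Y-antitone p u p≤u w∈u) ⟶-refl))

    Θ⇔≈π : CoverDetermined (PairsOf em 𝓢) Θ → Θ ⇔ _≈π_
    Θ⇔≈π Θ-cover-determined =
      congruence-⊆ Θ-cong isCompleteCongruence (λ {p} {q} → Θ⇒≈π p q) ,
      congruence-⊆ isCompleteCongruence Θ-cong (λ {p} {q} → ≈π⇒Θ Θ-cover-determined p q)

theorem6p3 :
  {ℓ : Level} (em : ExcludedMiddle (suc ℓ))
  (𝓢 : Tuple ℓ) → IsFactorizationSystem 𝓢 → TwoAcyclic 𝓢 → ImageCondition 𝓢 →
  Σ[ wd ∈ ((C : Pred (Tuple.S 𝓢) ℓ) → IsUpset 𝓢 C → RestrictsToPairs 𝓢 C) ]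
    ((C : Pred (Tuple.S 𝓢) ℓ) (up : IsUpset 𝓢 C) →
      let 𝓒 = restrict 𝓢 C
          L = PairsOf em 𝓢
          M = PairsOf em 𝓒
          π = restrictPair 𝓢 C (wd C up)
      in IsFactorizationSystem 𝓒 × TwoAcyclic 𝓒 × ImageCondition 𝓒 ×
         Surjective (CompleteLattice._≈_ L) (CompleteLattice._≈_ M) π ×
         IsCompleteLatticeHomomorphism L M π ×
         IsCompleteCongruence L (Fibres L M π) ×
         CoverDetermined L (Fibres L M π))
    ×
    ((Θ : Rel (CompleteLattice.Carrier (PairsOf em 𝓢)) (suc ℓ)) →
      IsCompleteCongruence (PairsOf em 𝓢) Θ → CoverDetermined (PairsOf em 𝓢) Θ →
      ∃[ C ] Σ[ up ∈ IsUpset 𝓢 C ]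
        Θ ⇔ Fibres (PairsOf em 𝓢) (PairsOf em (restrict 𝓢 C)) (restrictPair 𝓢 C (wd C up)))
theorem6p3 em 𝓢 fs acyclic image =
  restrictsToPairs ,
  (λ C up → let open Restriction image C up using
                  ( isFactorizationSystem; twoAcyclic; imageCondition; surjective
                  ; isCompleteLatticeHomomorphism; isCompleteCongruence; coverDetermined )
            in isFactorizationSystem , twoAcyclic acyclic , imageCondition , surjective ,
               isCompleteLatticeHomomorphism , isCompleteCongruence , coverDetermined acyclic) ,
  (λ Θ Θ-cong Θ-cover-determined →
    let open FromCongruence acyclic image Θ-cong using (Uncontracted; uncontracted-isUpset; Θ⇔≈π)
    in Uncontracted , uncontracted-isUpset , Θ⇔≈π Θ-cover-determined)
  where
  open FactorizationSystem em 𝓢 fs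
  open Restriction image using (restrictsToPairs)
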